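{- Let $R=(r_1,\dots,r_n)$ and $S=(s_1,\dots,s_n)$ be vectors of real numbers with $\sum_i r_i=\sum_j s_j$. Then $\mathcal{T}^{ -1}(R,S)\neq\emptyset$ if and only if $R=S$. The same is true for $\mathcal{T}^{ -1}_{\mathbb{Z}}(R,S)$: if $R$ and $S$ have nonnegative integer components, then $\mathcal{T}^{ -1}_{\mathbb{Z}}(R,S)\neq\emptyset$ if and only if $R=S$.
   Context: $\mathcal{T}(R,S)$ is the set of $n\times n$ matrices with nonnegative real entries whose $i$th row sum is $r_i$ and whose $j$th column sum is $s_j$ for all $i,j$. The reflection $r_{ -1}$ (in the line of slope $-1$) acts on $n\times n$ matrices as ordinary transposition. $\mathcal{T}^{ -1}(R,S)$ is the set of $A\in\mathcal{T}(R,S)$ with $r_{ -1}A=A$, i.e. $A^t=A$; $\mathcal{T}^{ -1}_{\mathbb{Z}}(R,S)$ is the set of those $A\in\mathcal{T}^{ -1}(R,S)$ all of whose entries are integers.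
   Formalization: The first claim is stated for vectors R and S with nonnegative components, because for arbitrary real vectors it fails: with n = 1 and R = S = (-1), R = S but the set of matrices is empty. -}

module Defs where

open import Algebra.Bundles.Raw using (RawMonoid)
import Algebra.Definitions.RawMonoid as RawMonoidDefs
open import Data.Integer.Base using (ℤ; 0ℤ)
open import Data.Nat.Base as ℕ using (ℕ)
import Data.Nat.Properties as ℕ
open import Data.Product.Base using (∃-syntax; _×_; _,_)
open import Data.Rational.Base as ℚ using (ℚ; 0ℚ; ½)
import Data.Rational.Properties as ℚ
open import Data.Rational.Solver using (module +-*-Solver)
open import Data.Vec.Functional using (Vector; transpose)
open import Data.Vec.Functional.Relation.Binary.Pointwise using (Pointwise)
open import Level using (0ℓ)
open import Relation.Binary.PropositionalEquality
  using (_≡_; refl; sym; trans; cong; subst; subst₂)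
open import Relation.Unary using (Pred; _∈_)

-- Real numbers: Cauchy sequences of rationals, with equality meaning
-- that the difference is a null sequence.

Eventually : Pred ℕ 0ℓ → Set
Eventually P = ∃[ N ] ∀ n → N ℕ.≤ n → P n

IsCauchy : (ℕ → ℚ) → Set
IsCauchy x = ∀ ε → 0ℚ ℚ.< ε →
  ∃[ N ] ∀ m n → N ℕ.≤ m → N ℕ.≤ n → ℚ.∣ x m ℚ.- x n ∣ ℚ.< ε

record ℝ : Set where
  constructor mkℝ
  field
    seq      : ℕ → ℚ
    isCauchy : IsCauchy seq

open ℝ public

infix 4 _≈_ _≤_

-- Records rather than functions, so that x and y can be inferred from
-- proofs of x ≈ y and x ≤ y.
record _≈_ (x y : ℝ) : Set where
  constructor mk≈
  field
    close : ∀ ε → 0ℚ ℚ.< ε →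
      Eventually λ n → ℚ.∣ seq x n ℚ.- seq y n ∣ ℚ.< ε

-- The slack ε is essential: a termwise comparison would not respect _≈_.
record _≤_ (x y : ℝ) : Set where
  constructor mk≤
  field
    below : ∀ ε → 0ℚ ℚ.< ε →
      Eventually λ n → seq x n ℚ.< seq y n ℚ.+ ε

open _≈_ public
open _≤_ public

fromℚ : ℚ → ℝ
fromℚ q = mkℝ (λ _ → q) λ ε 0<ε →
  0 , λ _ _ _ _ → subst (ℚ._< ε) (sym (cong ℚ.∣_∣ (ℚ.+-inverseʳ q))) 0<ε

fromℤ : ℤ → ℝ
fromℤ z = fromℚ (z ℚ./ 1)

0ℝ : ℝ
0ℝ = fromℤ 0ℤ

half-pos : ∀ ε → 0ℚ ℚ.< ε → 0ℚ ℚ.< ½ ℚ.* ε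
half-pos ε 0<ε =
  subst (ℚ._< ½ ℚ.* ε) (ℚ.*-zeroʳ ½) (ℚ.*-monoʳ-<-pos ½ 0<ε)

half+half : ∀ ε → ½ ℚ.* ε ℚ.+ ½ ℚ.* ε ≡ ε
half+half ε =
  trans (sym (ℚ.*-distribʳ-+ ε ½ ½)) (ℚ.*-identityˡ ε)

∣+-+∣< : ∀ {ε} a b c d →
         ℚ.∣ a ℚ.- b ∣ ℚ.< ½ ℚ.* ε → ℚ.∣ c ℚ.- d ∣ ℚ.< ½ ℚ.* ε →
         ℚ.∣ (a ℚ.+ c) ℚ.- (b ℚ.+ d) ∣ ℚ.< ε
∣+-+∣< {ε} a b c d p q =
  subst₂ ℚ._<_ (cong ℚ.∣_∣ (regroup a b c d)) (half+half ε)
    (ℚ.≤-<-trans (ℚ.∣p+q∣≤∣p∣+∣q∣ (a ℚ.- b) (c ℚ.- d)) (ℚ.+-mono-< p q))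
  where
  open +-*-Solver
  regroup : ∀ a b c d →
            (a ℚ.- b) ℚ.+ (c ℚ.- d) ≡ (a ℚ.+ c) ℚ.- (b ℚ.+ d)
  regroup = solve 4
    (λ a b c d → (a :- b) :+ (c :- d) := (a :+ c) :- (b :+ d)) refl

infixl 6 _+_

_+_ : ℝ → ℝ → ℝ
x + y = mkℝ (λ n → seq x n ℚ.+ seq y n) λ ε 0<ε →
  let M , p = isCauchy x (½ ℚ.* ε) (half-pos ε 0<ε)
      N , q = isCauchy y (½ ℚ.* ε) (half-pos ε 0<ε)
  in M ℕ.⊔ N , λ m n M⊔N≤m M⊔N≤n →
       ∣+-+∣< (seq x m) (seq x n) (seq y m) (seq y n)
       (p m n (ℕ.m⊔n≤o⇒m≤o M N M⊔N≤m) (ℕ.m⊔n≤o⇒m≤o M N M⊔N≤n))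
       (q m n (ℕ.m⊔n≤o⇒n≤o M N M⊔N≤m) (ℕ.m⊔n≤o⇒n≤o M N M⊔N≤n))

+-0-rawMonoid : RawMonoid 0ℓ 0ℓ
+-0-rawMonoid = record { Carrier = ℝ ; _≈_ = _≈_ ; _∙_ = _+_ ; ε = 0ℝ }

open RawMonoidDefs +-0-rawMonoid public using (sum)

IsInteger : Pred ℝ 0ℓ
IsInteger x = ∃[ z ] x ≈ fromℤ z

infix 4 _≋_

_≋_ : ∀ {n} → Vector ℝ n → Vector ℝ n → Set
_≋_ = Pointwise _≈_

Matrix : ℕ → Set
Matrix n = Vector (Vector ℝ n) n

-- Reflection in the line of slope -1, i.e. in the main diagonal.
r₋₁ : ∀ {n} → Matrix n → Matrix n
r₋₁ = transpose

𝒯 : ∀ {n} → Vector ℝ n → Vector ℝ n → Pred (Matrix n) 0ℓ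
𝒯 R S A = (∀ i j → 0ℝ ≤ A i j)
        × (∀ i → sum (λ j → A i j) ≈ R i)
        × (∀ j → sum (λ i → A i j) ≈ S j)

-- The superscript -1 names the reflection r₋₁; it is not an inverse.
𝒯⁻¹ : ∀ {n} → Vector ℝ n → Vector ℝ n → Pred (Matrix n) 0ℓ
𝒯⁻¹ R S A = A ∈ 𝒯 R S × Pointwise _≋_ (r₋₁ A) A

𝒯⁻¹-ℤ : ∀ {n} → Vector ℝ n → Vector ℝ n → Pred (Matrix n) 0ℓ
𝒯⁻¹-ℤ R S A = A ∈ 𝒯⁻¹ R S × (∀ i j → IsInteger (A i j))

{-# OPTIONS --safe #-}

-- A symmetric matrix has equal ith row and ith column sums, so R = S.
-- Conversely diag(R) is symmetric, is nonnegative (integral) when R is,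
-- and has row and column sums R.
module Submission where

open import Defs
open import Algebra.Bundles using (Monoid)
import Algebra.Properties.Monoid.Sum as MonoidSum
open import Data.Fin.Base using (zero; suc)
import Data.Integer.Base as ℤ
open import Data.Nat.Base as ℕ using (ℕ)
import Data.Nat.Properties as ℕ
open import Data.Product.Base using (_×_; _,_)
open import Data.Rational.Base as ℚ using (0ℚ; ½)
import Data.Rational.Properties as ℚ
open import Data.Rational.Solver using (module +-*-Solver)
open import Data.Vec.Functional using (Vector; tail)
open import Function.Base using (_∘_)
open import Function.Bundles using (_⇔_; mk⇔)
open import Level using (0ℓ)
open import Relation.Binary.PropositionalEquality
  using (_≡_; refl; sym; trans; cong; subst)
open import Relation.Unary using (Pred; Satisfiable)

-- If `A` is symmetric, its ith row and ith column have the same entries up to `_≈_`, so the two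
-- sums agree and `R ≋ S` (`𝒯⁻¹⇒≋`). For the converse one witness, `diag R`, serves both claims:
-- every entry is either zero or some `R i`, so it inherits nonnegativity and integrality
-- (`diag-elim`), and its margins are `R` (`diag-rowSum`, `diag-columnSum`). The diagonal matrix is
-- pure monoid algebra; the Cauchy estimates enter only in showing that `ℝ` is an additive monoid.

module Diagonal {a ℓ} (M : Monoid a ℓ) where
  open Monoid M
    using (Carrier; ε; ∙-congˡ; identityˡ; identityʳ)
    renaming (_≈_ to _≈ᴹ_; refl to reflᴹ; trans to transᴹ)
  open MonoidSum M using (sum-replicate-zero; sum-cong-≋)
    renaming (sum to sumᴹ)

  -- Recursion on both indices, rather than a test for their equality, lets each row sum unfold
  -- along the recursion of the sum itself.
  diag : ∀ {n} → Vector Carrier n → Vector (Vector Carrier n) n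
  diag xs zero    zero    = xs zero
  diag xs zero    (suc j) = ε
  diag xs (suc i) zero    = ε
  diag xs (suc i) (suc j) = diag (tail xs) i j

  diag-elim : ∀ {p n} (P : Pred Carrier p) {xs : Vector Carrier n} →
              P ε → (∀ i → P (xs i)) → ∀ i j → P (diag xs i j)
  diag-elim P Pε Pxs zero    zero    = Pxs zero
  diag-elim P Pε Pxs zero    (suc j) = Pε
  diag-elim P Pε Pxs (suc i) zero    = Pε
  diag-elim P Pε Pxs (suc i) (suc j) = diag-elim P Pε (Pxs ∘ suc) i j

  diag-symmetric : ∀ {n} (xs : Vector Carrier n) i j →
                   diag xs j i ≈ᴹ diag xs i j
  diag-symmetric xs zero    zero    = reflᴹ
  diag-symmetric xs zero    (suc j) = reflᴹ
  diag-symmetric xs (suc i) zero    = reflᴹ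
  diag-symmetric xs (suc i) (suc j) = diag-symmetric (tail xs) i j

  diag-rowSum : ∀ {n} (xs : Vector Carrier n) i → sumᴹ (diag xs i) ≈ᴹ xs i
  diag-rowSum {ℕ.suc n} xs zero    =
    transᴹ (∙-congˡ (sum-replicate-zero n)) (identityʳ (xs zero))
  diag-rowSum {ℕ.suc n} xs (suc i) =
    transᴹ (identityˡ _) (diag-rowSum (tail xs) i)

  -- By symmetry, column `j` is row `j`.
  diag-columnSum : ∀ {n} (xs : Vector Carrier n) j →
                   sumᴹ (λ i → diag xs i j) ≈ᴹ xs j
  diag-columnSum xs j =
    transᴹ (sum-cong-≋ (diag-symmetric xs j)) (diag-rowSum xs j)

∣p-p∣<ε : ∀ p {ε} → 0ℚ ℚ.< ε → ℚ.∣ p ℚ.- p ∣ ℚ.< ε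
∣p-p∣<ε p {ε} = subst (ℚ._< ε) (sym (cong ℚ.∣_∣ (ℚ.+-inverseʳ p)))

∣p-q∣≡∣q-p∣ : ∀ p q → ℚ.∣ p ℚ.- q ∣ ≡ ℚ.∣ q ℚ.- p ∣
∣p-q∣≡∣q-p∣ p q =
  trans (sym (ℚ.∣-p∣≡∣p∣ (p ℚ.- q))) (cong ℚ.∣_∣ (neg-sub p q))
  where
  open +-*-Solver
  neg-sub : ∀ p q → ℚ.- (p ℚ.- q) ≡ q ℚ.- p
  neg-sub = solve 2 (λ p q → :- (p :- q) := q :- p) refl

-- The estimate for sums already contains this one: in `(p + q) - (q + r)` the middle term cancels.
∣p-r∣<ε : ∀ p q r {ε} →
          ℚ.∣ p ℚ.- q ∣ ℚ.< ½ ℚ.* ε → ℚ.∣ q ℚ.- r ∣ ℚ.< ½ ℚ.* ε →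
          ℚ.∣ p ℚ.- r ∣ ℚ.< ε
∣p-r∣<ε p q r {ε} p≈q q≈r =
  subst (ℚ._< ε) (cong ℚ.∣_∣ (cancel p q r)) (∣+-+∣< p q q r p≈q q≈r)
  where
  open +-*-Solver
  cancel : ∀ p q r → (p ℚ.+ q) ℚ.- (q ℚ.+ r) ≡ p ℚ.- r
  cancel = solve 3 (λ p q r → (p :+ q) :- (q :+ r) := p :- r) refl

eventually-zipWith : ∀ {P Q T : Pred ℕ 0ℓ} → (∀ n → P n → Q n → T n) →
                     Eventually P → Eventually Q → Eventually T
eventually-zipWith f (M , p) (N , q) = M ℕ.⊔ N , λ n M⊔N≤n →
  f n (p n (ℕ.m⊔n≤o⇒m≤o M N M⊔N≤n)) (q n (ℕ.m⊔n≤o⇒n≤o M N M⊔N≤n))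

seq-≡⇒≈ : ∀ {x y} → (∀ n → seq x n ≡ seq y n) → x ≈ y
seq-≡⇒≈ {x} eq = mk≈ λ ε 0<ε → 0 , λ n _ →
  subst (λ q → ℚ.∣ seq x n ℚ.- q ∣ ℚ.< ε) (eq n) (∣p-p∣<ε (seq x n) 0<ε)

≈-refl : ∀ {x} → x ≈ x
≈-refl = seq-≡⇒≈ λ _ → refl

≈-sym : ∀ {x y} → x ≈ y → y ≈ x
≈-sym {x} {y} x≈y = mk≈ λ ε 0<ε →
  let N , p = close x≈y ε 0<ε in
  N , λ n N≤n →
    subst (ℚ._< ε) (∣p-q∣≡∣q-p∣ (seq x n) (seq y n)) (p n N≤n)

≈-trans : ∀ {x y z} → x ≈ y → y ≈ z → x ≈ z
≈-trans {x} {y} {z} x≈y y≈z = mk≈ λ ε 0<ε →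
  eventually-zipWith (λ n → ∣p-r∣<ε (seq x n) (seq y n) (seq z n))
    (close x≈y (½ ℚ.* ε) (half-pos ε 0<ε))
    (close y≈z (½ ℚ.* ε) (half-pos ε 0<ε))

+-cong : ∀ {x y u v} → x ≈ y → u ≈ v → x + u ≈ y + v
+-cong {x} {y} {u} {v} x≈y u≈v = mk≈ λ ε 0<ε →
  eventually-zipWith
    (λ n → ∣+-+∣< (seq x n) (seq y n) (seq u n) (seq v n))
    (close x≈y (½ ℚ.* ε) (half-pos ε 0<ε))
    (close u≈v (½ ℚ.* ε) (half-pos ε 0<ε))

≤-refl : ∀ {x} → x ≤ x
≤-refl {x} = mk≤ λ ε 0<ε → 0 , λ n _ →
  subst (ℚ._< seq x n ℚ.+ ε) (ℚ.+-identityʳ (seq x n))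
    (ℚ.+-monoʳ-< (seq x n) 0<ε)

-- Built on the same operations as `+-0-rawMonoid`, so lemmas on monoid sums apply to the `sum` in
-- `𝒯`. The laws hold term by term in `ℚ`.
+-0-monoid : Monoid 0ℓ 0ℓ
+-0-monoid = record
  { Carrier  = ℝ
  ; _≈_      = _≈_
  ; _∙_      = _+_
  ; ε        = 0ℝ
  ; isMonoid = record
    { isSemigroup = record
      { isMagma = record
        { isEquivalence = record
          { refl = ≈-refl ; sym = ≈-sym ; trans = ≈-trans }
        ; ∙-cong = +-cong
        }
      ; assoc = λ x y z →
          seq-≡⇒≈ λ n → ℚ.+-assoc (seq x n) (seq y n) (seq z n)
      }
    ; identity = (λ x → seq-≡⇒≈ λ n → ℚ.+-identityˡ (seq x n))
               , (λ x → seq-≡⇒≈ λ n → ℚ.+-identityʳ (seq x n))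
    }
  }

open MonoidSum +-0-monoid using (sum-cong-≋)
open Diagonal +-0-monoid

diag-∈-𝒯⁻¹ : ∀ {n} {R S : Vector ℝ n} →
             (∀ i → 0ℝ ≤ R i) → R ≋ S → 𝒯⁻¹ R S (diag R)
diag-∈-𝒯⁻¹ {R = R} 0≤R R≋S =
  ( diag-elim (0ℝ ≤_) ≤-refl 0≤R
  , diag-rowSum R
  , λ j → ≈-trans (diag-columnSum R j) (R≋S j)
  ) , diag-symmetric R

𝒯⁻¹⇒≋ : ∀ {n} {R S : Vector ℝ n} {A} → 𝒯⁻¹ R S A → R ≋ S
𝒯⁻¹⇒≋ ((_ , rows , cols) , symm) i =
  -- `R i` is the sum of row `i`, hence of column `i`, which is `S i`.
  ≈-trans (≈-sym (rows i)) (≈-trans (sum-cong-≋ λ j → ≈-sym (symm i j)) (cols i))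

theorem3 : ∀ (n : ℕ) (R S : Vector ℝ n) →
    (∀ i → 0ℝ ≤ R i) → (∀ j → 0ℝ ≤ S j) →
    sum R ≈ sum S →
    (Satisfiable (𝒯⁻¹ R S) ⇔ R ≋ S)
    × ((∀ i → IsInteger (R i)) → (∀ j → IsInteger (S j)) →
    (Satisfiable (𝒯⁻¹-ℤ R S) ⇔ R ≋ S))
theorem3 n R S 0≤R _ _ =
    mk⇔ (λ (_ , A∈) → 𝒯⁻¹⇒≋ A∈) (λ R≋S → diag R , diag-∈-𝒯⁻¹ 0≤R R≋S)
  , λ R-int _ → mk⇔
      (λ (_ , A∈ , _) → 𝒯⁻¹⇒≋ A∈)
      (λ R≋S → diag R , diag-∈-𝒯⁻¹ 0≤R R≋S ,
        -- The off-diagonal entry `0ℝ` is by definition `fromℤ 0ℤ`.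
        diag-elim IsInteger (ℤ.0ℤ , ≈-refl) R-int)
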